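{- Every graph in $\varepsilon_{23}$ has a node of degree $2$.
   Context: All graphs are finite, simple and connected. An Euler graph is a connected graph all of whose nodes have even degree. A cycle of length $n$ is of type $i$ if $n\equiv i\pmod 4$. $\varepsilon_{23}$ is the class of Euler graphs in which every cycle has length $\equiv 2$ or $\equiv 3\pmod 4$ and which contain at least one cycle of each of the types $2$ and $3$. -}

module Defs where

open import Data.Nat using (ℕ; zero; suc; _≤_; _∸_; _%_)
open import Data.Nat.Divisibility using (_∣_)
open import Data.Fin using (Fin; toℕ)
open import Data.Bool using (Bool; true; false; if_then_else_)
open import Data.List using (allFin; map)
open import Data.Nat.ListAction using (sum)
open import Data.Product using (_×_; ∃; ∃-syntax)
open import Data.Sum using (_⊎_)
open import Function.Definitions using (Injective)
open import Relation.Binary.PropositionalEquality using (_≡_)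

record Graph (n : ℕ) : Set where
  field
    adj    : Fin n → Fin n → Bool
    sym    : ∀ i j → adj i j ≡ adj j i
    irrefl : ∀ i → adj i i ≡ false
open Graph public

degree : ∀ {n} → Graph n → Fin n → ℕ
degree G i = sum (map (λ j → if adj G i j then 1 else 0) (allFin _))

data Walk {n} (G : Graph n) : Fin n → Fin n → Set where
  here : ∀ {i} → Walk G i i
  step : ∀ {i k j} → adj G i k ≡ true → Walk G k j → Walk G i j

Connected : ∀ {n} → Graph n → Set
Connected {n} G = Fin n × (∀ (i j : Fin n) → Walk G i j)

Euler : ∀ {n} → Graph n → Set
Euler G = Connected G × (∀ i → 2 ∣ degree G i)

IsCycle : ∀ {n} → Graph n → (k : ℕ) → (Fin k → Fin n) → Set
IsCycle {n} G k f =
  (3 ≤ k) × Injective _≡_ _≡_ f ×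
  (∀ (s t : Fin k) →
     (suc (toℕ s) ≡ toℕ t) ⊎ (suc (toℕ s) ≡ k × toℕ t ≡ 0) →
     adj G (f s) (f t) ≡ true)

HasCycleOfLength : ∀ {n} → Graph n → ℕ → Set
HasCycleOfLength G k = ∃[ f ] IsCycle G k f

ε23 : ∀ {n} → Graph n → Set
ε23 G =
  Euler G ×
  (∀ k → HasCycleOfLength G k → (k % 4 ≡ 2) ⊎ (k % 4 ≡ 3)) ×
  (∃[ k ] (HasCycleOfLength G k × k % 4 ≡ 2)) ×
  (∃[ k ] (HasCycleOfLength G k × k % 4 ≡ 3))

{-# OPTIONS --safe #-}
module Submission where

-- If no vertex has degree 2, all degrees are at least 4, and then G contains a
-- subdivision of K₄ in which three edges, forming a path, are not subdivided:
-- in a longest path p q … y … z … with p adjacent to y and z, reverse the part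
-- before y; the new end u is adjacent to y and has a third neighbour t on the
-- path.  If t lies beyond y we have the subdivision, and otherwise u with t
-- and y is the same configuration with a shorter initial part.  Modulo 4 the
-- cycle lengths of such a subdivision cannot all be 2 or 3.

open import Defs
open import Data.Bool using (true; false; if_then_else_)
open import Data.Bool.Properties using () renaming (_≟_ to _≟ᵇ_)
open import Data.Fin using (Fin; zero; suc; toℕ; _≟_)
open import Data.Fin.Properties using (injective⇒≤; toℕ-fromℕ<; all?; any?)
open import Data.List using (List; []; _∷_; _++_; length; lookup; reverse; filter; map; allFin)
open import Data.List.Membership.Propositional using (_∈_)
open import Data.List.Membership.Propositional.Properties using (∈-∃++; ∈-++⁻; ∈-++⁺ʳ; ∈-allFin; ∈-filter⁺)
open import Data.List.Properties using (length-++; length-reverse; ++-assoc; unfold-reverse)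
open import Data.List.Relation.Binary.Permutation.Propositional using (_↭_; prep; swap; ↭-refl; ↭-sym; ↭-trans; ↭-reflexive; ↭⇒↭ₛ)
open import Data.List.Relation.Binary.Permutation.Propositional.Properties using (↭-reverse; ↭-length; shift; ++⁺ʳ) renaming (++⁺ˡ to ↭-++⁺ˡ)
import Data.List.Relation.Binary.Permutation.Setoid.Properties as Permₛ
open import Data.List.Relation.Binary.Sublist.Propositional using (_⊆_; []; _∷_; _∷ʳ_; ⊆-refl; minimum)
open import Data.List.Relation.Binary.Sublist.Propositional.Properties using (All-resp-⊆; ++⁺; ++⁺ˡ)
open import Data.List.Relation.Unary.All using (All; []; _∷_)
open import Data.List.Relation.Unary.All.Properties using (¬Any⇒All¬; all-filter)
open import Data.List.Relation.Unary.AllPairs using ([]; _∷_)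
open import Data.List.Relation.Unary.Any using (here; there)
open import Data.List.Relation.Unary.Linked using (Linked; [-]; _∷_)
open import Data.List.Relation.Unary.Unique.Propositional using (Unique)
open import Data.List.Relation.Unary.Unique.Propositional.Properties using (allFin⁺; filter⁺)
open import Data.Nat using (ℕ; zero; suc; _+_; _%_; _≤_; _<_; z≤n; s≤s)
open import Data.Nat.Divisibility using (_∣_; divides)
open import Data.Nat.DivMod using (_mod_; %-distribˡ-+; m%n%n≡m%n; m%n<n)
open import Data.Nat.ListAction using (sum)
open import Data.Nat.Properties using (≤-refl; ≤-trans; ≤-reflexive; m≤m+n; +-comm; +-suc; <⇒≱)
import Data.Nat.Properties as ℕ
open import Data.Product using (_×_; _,_; ∃-syntax; proj₁; proj₂)
open import Data.Sum using (_⊎_; inj₁; inj₂)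
open import Function using (_∘_)
open import Function.Definitions using (Injective)
open import Relation.Binary.PropositionalEquality using (_≡_; _≢_; refl; trans; cong; cong₂; subst; setoid) renaming (sym to ≡-sym)
open import Relation.Nullary using (¬_; Dec; yes; no; contradiction)
open import Relation.Nullary.Decidable using (_⊎-dec_; _→-dec_; ¬?; from-yes)

-- Lists without repetition

module _ {A : Set} where

  Unique-resp-↭ : {xs ys : List A} → xs ↭ ys → Unique xs → Unique ys
  Unique-resp-↭ p = Permₛ.Unique-resp-↭ (setoid A) (↭⇒↭ₛ p)

  Unique-resp-⊆ : {xs ys : List A} → xs ⊆ ys → Unique ys → Unique xs
  Unique-resp-⊆ []         []       = []
  Unique-resp-⊆ (_ ∷ʳ p)   (_ ∷ us) = Unique-resp-⊆ p us
  Unique-resp-⊆ (refl ∷ p) (u ∷ us) = All-resp-⊆ p u ∷ Unique-resp-⊆ p us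

  lookup-≢ : ∀ {x : A} {xs} → All (x ≢_) xs → ∀ i → x ≢ lookup xs i
  lookup-≢ (x≢ ∷ _)  zero    = x≢
  lookup-≢ (_ ∷ x≢s) (suc i) = lookup-≢ x≢s i

  lookup-injective : ∀ {xs : List A} → Unique xs → Injective _≡_ _≡_ (lookup xs)
  lookup-injective (_ ∷ _)  {zero}  {zero}  _  = refl
  lookup-injective (u ∷ _)  {zero}  {suc j} eq = contradiction eq (lookup-≢ u j)
  lookup-injective (u ∷ _)  {suc i} {zero}  eq = contradiction (≡-sym eq) (lookup-≢ u i)
  lookup-injective (_ ∷ us) {suc i} {suc j} eq = cong suc (lookup-injective us eq)

  -- Carries distinctness of vertices over to the list in which the segment from `a` to `u` is
  -- traversed backwards.
  ↭-flip : ∀ (a : A) B u D → a ∷ B ++ u ∷ D ↭ u ∷ reverse B ++ a ∷ D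
  ↭-flip a B u D =
    ↭-trans (prep a (shift u B D))
    (↭-trans (swap a u (++⁺ʳ D (↭-sym (↭-reverse B))))
             (prep u (↭-sym (shift a (reverse B) D))))

-- Cycle lengths modulo 4

Good : ℕ → Set
Good k = (k % 4 ≡ 2) ⊎ (k % 4 ≡ 3)

good? : ∀ k → Dec (Good k)
good? k = (k % 4 ℕ.≟ 2) ⊎-dec (k % 4 ℕ.≟ 3)

-- A record rather than a bare equation of residues, so that `m` and `n` can be inferred from the
-- type of a proof.
record _≡₄_ (m n : ℕ) : Set where
  constructor mod-4
  field same-residue : m % 4 ≡ n % 4

+-cong₄ : ∀ {m m′ n n′} → m ≡₄ m′ → n ≡₄ n′ → (m + n) ≡₄ (m′ + n′)
+-cong₄ {m} {m′} {n} {n′} (mod-4 p) (mod-4 q) = mod-4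
  (trans (%-distribˡ-+ m n 4)
  (trans (cong₂ (λ a b → (a + b) % 4) p q) (≡-sym (%-distribˡ-+ m′ n′ 4))))

+-congˡ₄ : ∀ k {n n′} → n ≡₄ n′ → (k + n) ≡₄ (k + n′)
+-congˡ₄ k = +-cong₄ (mod-4 {k} refl)

Good-resp-≡₄ : ∀ {m n} → m ≡₄ n → Good m → Good n
Good-resp-≡₄ (mod-4 eq) = subst (λ r → (r ≡ 2) ⊎ (r ≡ 3)) eq

residue : ∀ m → m ≡₄ toℕ (m mod 4)
residue m = mod-4 (trans (≡-sym (m%n%n≡m%n m 4)) (cong (_% 4) (≡-sym (toℕ-fromℕ< (m%n<n m 4)))))

-- The lengths of five of the cycles of a K4 (below) with |B| = b, |C| = c, |S| = s.
Incompatible : ℕ → ℕ → ℕ → Set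
Incompatible b c s =
  Good (3 + b) → Good (4 + s) → Good (3 + (b + s)) → Good (3 + (c + s)) → ¬ Good (4 + (b + c))

incompatible? : ∀ b c s → Dec (Incompatible b c s)
incompatible? b c s =
  good? (3 + b) →-dec good? (4 + s) →-dec good? (3 + (b + s)) →-dec
  good? (3 + (c + s)) →-dec ¬? (good? (4 + (b + c)))

-- Evaluation of all 64 cases. By hand: the first three conditions force `b` ≡ 0 and `s` ≡ 3 modulo
-- 4; then the fourth requires `c` ≡ 0 or 1, and the fifth `c` ≡ 2 or 3.
incompatible-residues : ∀ (b c s : Fin 4) → Incompatible (toℕ b) (toℕ c) (toℕ s)
incompatible-residues = from-yes (all? {4} λ b → all? {4} λ c → all? {4} λ s →
  incompatible? (toℕ b) (toℕ c) (toℕ s))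

incompatible : ∀ b c s → Incompatible b c s
incompatible b c s g₁ g₂ g₃ g₄ g₅ =
  incompatible-residues (b mod 4) (c mod 4) (s mod 4)
    (Good-resp-≡₄ (+-congˡ₄ 3 b₄) g₁)
    (Good-resp-≡₄ (+-congˡ₄ 4 s₄) g₂)
    (Good-resp-≡₄ (+-congˡ₄ 3 (+-cong₄ b₄ s₄)) g₃)
    (Good-resp-≡₄ (+-congˡ₄ 3 (+-cong₄ c₄ s₄)) g₄)
    (Good-resp-≡₄ (+-congˡ₄ 4 (+-cong₄ b₄ c₄)) g₅)
  where
  b₄ = residue b
  c₄ = residue c
  s₄ = residue s

module _ {n : ℕ} (G : Graph n) where

  open import Data.List.Membership.DecPropositional (_≟_ {n}) using (_∈?_)

  -- Walks as lists of inner vertices, paths and cycles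

  V : Set
  V = Fin n

  Adj : V → V → Set
  Adj u v = adj G u v ≡ true

  Adj-sym : ∀ {u v} → Adj u v → Adj v u
  Adj-sym {u} {v} = trans (sym G v u)

  Adj⇒≢ : ∀ {u v} → Adj u v → v ≢ u
  Adj⇒≢ {u} uv refl with trans (≡-sym uv) (irrefl G u)
  ... | ()

  -- xs lists the inner vertices of a walk from a to b.
  Joins : V → List V → V → Set
  Joins a []       b = Adj a b
  Joins a (x ∷ xs) b = Adj a x × Joins x xs b

  Joins-++ : ∀ {a} xs {b ys c} → Joins a xs b → Joins b ys c → Joins a (xs ++ b ∷ ys) c
  Joins-++ []       ab       p = ab , p
  Joins-++ (x ∷ xs) (ax , q) p = ax , Joins-++ xs q p

  Joins-reverse : ∀ {a} xs {b} → Joins a xs b → Joins b (reverse xs) a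
  Joins-reverse []       ab       = Adj-sym ab
  Joins-reverse (x ∷ xs) {b} (ax , q) =
    subst (λ l → Joins b l _) (≡-sym (unfold-reverse x xs))
      (Joins-++ (reverse xs) (Joins-reverse xs q) (Adj-sym ax))

  -- Finds the predecessor of a vertex on a path, which becomes the new end when the part before
  -- that vertex is reversed.
  Joins-unsnoc : ∀ {a} x xs {b} → Joins a (x ∷ xs) b →
                 ∃[ ys ] ∃[ y ] (x ∷ xs ≡ ys ++ y ∷ []) × Joins a ys y × Adj y b
  Joins-unsnoc x []        (ax , xb) = [] , x , refl , ax , xb
  Joins-unsnoc x (x′ ∷ xs) (ax , q)
    with ys , y , eq , r , yb ← Joins-unsnoc x′ xs q
    = x ∷ ys , y , cong (x ∷_) eq , (ax , r) , yb

  Linked-split : ∀ {a} xs {b ys} → Linked Adj (a ∷ xs ++ b ∷ ys) → Joins a xs b × Linked Adj (b ∷ ys)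
  Linked-split []       (ab ∷ l) = ab , l
  Linked-split (x ∷ xs) (ax ∷ l) with q , r ← Linked-split xs l = (ax , q) , r

  Linked-join : ∀ {a} xs {b ys} → Joins a xs b → Linked Adj (b ∷ ys) → Linked Adj (a ∷ xs ++ b ∷ ys)
  Linked-join []       ab       l = ab ∷ l
  Linked-join (x ∷ xs) (ax , q) l = ax ∷ Linked-join xs q l

  Joins-lookup : ∀ {a} xs {b} → Joins a xs b → ∀ s t → suc (toℕ s) ≡ toℕ t →
                 Adj (lookup (a ∷ xs) s) (lookup (a ∷ xs) t)
  Joins-lookup (x ∷ xs) (ax , _) zero    (suc zero) _  = ax
  Joins-lookup (x ∷ xs) (_ , q)  (suc s) (suc t)    eq = Joins-lookup xs q s t (ℕ.suc-injective eq)

  Joins-last : ∀ {a} xs {b} → Joins a xs b → ∀ s → suc (toℕ s) ≡ length (a ∷ xs) →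
               Adj (lookup (a ∷ xs) s) b
  Joins-last []       ab      zero    _  = ab
  Joins-last (x ∷ xs) (_ , q) (suc s) eq = Joins-last xs q s (ℕ.suc-injective eq)

  -- Positions in the list serve as the indices of the cycle; the edge back to index 0 is the last
  -- edge of the closed walk.
  closed⇒cycle : ∀ {a} xs → Joins a xs a → Unique (a ∷ xs) → 2 ≤ length xs →
                 HasCycleOfLength G (length (a ∷ xs))
  closed⇒cycle {a} xs q u 2≤ = lookup (a ∷ xs) , s≤s 2≤ , lookup-injective u , consecutive
    where
    consecutive : ∀ s t → (suc (toℕ s) ≡ toℕ t) ⊎ (suc (toℕ s) ≡ length (a ∷ xs) × toℕ t ≡ 0) →
                  Adj (lookup (a ∷ xs) s) (lookup (a ∷ xs) t)
    consecutive s t    (inj₁ eq)       = Joins-lookup xs q s t eq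
    consecutive s zero (inj₂ (eq , _)) = Joins-last xs q s eq

  -- Subdivisions of K₄

  -- Branch vertices a, u, w, x; the edges aw, wu and ux are not subdivided.
  record K4 : Set where
    field
      {a u w x} : V
      B C S     : List V
      aBu       : Joins a B u
      aw        : Adj a w
      uw        : Adj u w
      wCx       : Joins w C x
      ux        : Adj u x
      xSa       : Joins x S a
      distinct  : Unique (a ∷ B ++ u ∷ w ∷ C ++ x ∷ S)

  -- The cycles, in the order of the premises of `Incompatible`, are a B u w, a w u x S, a B u x S,
  -- a w C x S, and a B u x C w with `C` traversed backwards.
  good-cycles⇒¬K4 : (∀ k → HasCycleOfLength G k → Good k) → ¬ K4
  good-cycles⇒¬K4 good k4 =
    incompatible (length B) (length C) (length S)
      (subst Good length₁ (good _ (closed⇒cycle (B ++ u ∷ w ∷ [])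
        (Joins-++ B aBu (uw , Adj-sym aw))
        (Unique-resp-⊆ (refl ∷ ++⁺ ⊆-refl (refl ∷ refl ∷ minimum _)) distinct)
        (two B))))
      (good _ (closed⇒cycle (w ∷ u ∷ x ∷ S)
        (aw , Adj-sym uw , ux , xSa)
        (Unique-resp-↭ (prep a (swap u w ↭-refl))
          (Unique-resp-⊆ (refl ∷ ++⁺ˡ B (refl ∷ refl ∷ ++⁺ˡ C ⊆-refl)) distinct))
        (s≤s (s≤s z≤n))))
      (subst Good length₃ (good _ (closed⇒cycle (B ++ u ∷ x ∷ S)
        (Joins-++ B aBu (ux , xSa))
        (Unique-resp-⊆ (refl ∷ ++⁺ ⊆-refl (refl ∷ w ∷ʳ ++⁺ˡ C ⊆-refl)) distinct)
        (two B))))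
      (subst Good length₄ (good _ (closed⇒cycle (w ∷ C ++ x ∷ S)
        (aw , Joins-++ C wCx xSa)
        (Unique-resp-⊆ (refl ∷ ++⁺ˡ B (u ∷ʳ ⊆-refl)) distinct)
        (s≤s (nonempty C)))))
      (subst Good length₅ (good _ (closed⇒cycle (B ++ u ∷ x ∷ reverse C ++ w ∷ [])
        (Joins-++ B aBu (ux , Joins-++ (reverse C) (Joins-reverse C wCx) (Adj-sym aw)))
        (Unique-resp-↭ (prep a (↭-++⁺ˡ B (prep u (↭-flip w C x []))))
          (Unique-resp-⊆ (refl ∷ ++⁺ ⊆-refl (refl ∷ refl ∷ ++⁺ ⊆-refl (refl ∷ minimum S))) distinct))
        (two B))))
    where
    open K4 k4

    nonempty : ∀ (xs : List V) {y ys} → 1 ≤ length (xs ++ y ∷ ys)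
    nonempty []      = s≤s z≤n
    nonempty (_ ∷ _) = s≤s z≤n

    two : ∀ (xs : List V) {y z ys} → 2 ≤ length (xs ++ y ∷ z ∷ ys)
    two []       = s≤s (s≤s z≤n)
    two (_ ∷ xs) = s≤s (nonempty xs)

    length-++-∷ : ∀ (xs : List V) y ys → length (xs ++ y ∷ ys) ≡ suc (length xs + length ys)
    length-++-∷ xs y ys = trans (length-++ xs) (+-suc (length xs) (length ys))

    length₃ : length (a ∷ B ++ u ∷ x ∷ S) ≡ 3 + (length B + length S)
    length₃ = cong suc (trans (length-++-∷ B u (x ∷ S)) (cong suc (+-suc (length B) (length S))))

    length₁ : length (a ∷ B ++ u ∷ w ∷ []) ≡ 3 + length B
    length₁ = cong suc (trans (length-++ B) (+-comm (length B) 2))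

    length₄ : length (a ∷ w ∷ C ++ x ∷ S) ≡ 3 + (length C + length S)
    length₄ = cong (2 +_) (length-++-∷ C x S)

    length₅ : length (a ∷ B ++ u ∷ x ∷ reverse C ++ w ∷ []) ≡ 4 + (length B + length C)
    length₅ = cong suc (trans (length-++ B)
      (trans (cong (λ l → length B + (2 + l))
               (trans (length-++ (reverse C))
                 (trans (cong (_+ 1) (length-reverse C)) (+-comm (length C) 1))))
        (trans (+-suc (length B) _) (cong suc (trans (+-suc (length B) _) (cong suc (+-suc (length B) _)))))))

  -- The path from `w` is cut at `x`. The branch from `x` back to `a` follows the path as far as `y`
  -- and then takes the edge from `y` to `a`; it is a single edge if `y` is `x`.
  K4-ordered : ∀ {a u w x y} B C {E} → Joins a B u → Adj a w → Adj u w →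
               Linked Adj (w ∷ C ++ x ∷ E) → Unique (a ∷ B ++ u ∷ w ∷ C ++ x ∷ E) →
               Adj u x → Adj a y → y ∈ x ∷ E → K4
  K4-ordered B C aBu aw uw l d ux ay (here refl) = record
    { B = B ; C = C ; S = [] ; aBu = aBu ; aw = aw ; uw = uw ; ux = ux
    ; wCx = proj₁ (Linked-split C l) ; xSa = Adj-sym ay
    ; distinct = Unique-resp-⊆ (refl ∷ ++⁺ ⊆-refl (refl ∷ refl ∷ ++⁺ ⊆-refl (refl ∷ minimum _))) d }
  K4-ordered {y = y} B C aBu aw uw l d ux ay (there y∈E)
    with S , _ , refl ← ∈-∃++ y∈E
    with wCx , l′ ← Linked-split C l
    = record
    { B = B ; C = C ; S = S ++ y ∷ [] ; aBu = aBu ; aw = aw ; uw = uw ; ux = ux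
    ; wCx = wCx ; xSa = Joins-++ S (proj₁ (Linked-split S l′)) (Adj-sym ay)
    ; distinct = Unique-resp-⊆
        (refl ∷ ++⁺ ⊆-refl (refl ∷ refl ∷ ++⁺ ⊆-refl (refl ∷ ++⁺ (⊆-refl {x = S}) (refl ∷ minimum _)))) d }

  K4-intro : ∀ {a u w x y} B C → Joins a B u → Adj a w → Adj u w →
             Linked Adj (w ∷ C) → Unique (a ∷ B ++ u ∷ w ∷ C) →
             Adj u x → x ∈ C → Adj a y → y ∈ C → K4
  K4-intro {a} {u} {w} {x} {y} B C aBu aw uw l d ux x∈C ay y∈C
    with C₁ , E , refl ← ∈-∃++ x∈C
    with ∈-++⁻ C₁ y∈C
  ... | inj₂ y∈E = K4-ordered B C₁ aBu aw uw l d ux ay y∈E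
  -- If `y` precedes `x`, the roles of `a` and `u` are exchanged and `B` is reversed.
  ... | inj₁ y∈C₁
    with C₂ , F , refl ← ∈-∃++ y∈C₁
    rewrite ++-assoc C₂ (y ∷ F) (x ∷ E)
    = K4-ordered (reverse B) C₂ (Joins-reverse B aBu) uw aw l
        (Unique-resp-↭ (↭-flip a B u _) d) ay ux (there (∈-++⁺ʳ F (here refl)))

  -- Longest paths

  -- The form in which minimum degree 3 is used: a neighbour can always be chosen outside two given
  -- vertices.
  module _ (third : ∀ v q r → ∃[ t ] (Adj v t × t ≢ q × t ≢ r)) where

    -- Paths with `l` vertices are treated, given that every path with one more vertex yields a
    -- `K4`. So every neighbour of an end may be assumed to lie on the path.
    module _ (l : ℕ)
             (longer : ∀ {v L} → Linked Adj (v ∷ L) → Unique (v ∷ L) → length L ≡ l → K4) where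

      neighbour-on-path : ∀ {v L t} → Linked Adj (v ∷ L) → Unique (v ∷ L) → length (v ∷ L) ≡ l →
                          Adj v t → K4 ⊎ t ∈ L
      neighbour-on-path {v} {L} {t} p d len vt with t ∈? v ∷ L
      ... | yes (here t≡v)  = contradiction t≡v (Adj⇒≢ vt)
      ... | yes (there t∈L) = inj₂ t∈L
      ... | no  t∉          = inj₁ (longer (Adj-sym vt ∷ p) (¬Any⇒All¬ _ t∉ ∷ d) len)

      mutual
        -- The part before `y` is reversed, so that the predecessor `u` of `y` becomes the end. The
        -- bound `k` on the initial part makes the mutual recursion terminate: `rotated` returns
        -- here only with a smaller `k`.
        rotate : ∀ k {p q y z} Q {D} → length Q ≤ k →
                 Linked Adj (p ∷ q ∷ Q ++ y ∷ D) → Unique (p ∷ q ∷ Q ++ y ∷ D) →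
                 length (p ∷ q ∷ Q ++ y ∷ D) ≡ l →
                 Adj p y → Adj p z → z ∈ D → K4
        rotate k {p} {q} {y} Q {D} Q≤k lp d len py pz z∈D
          with pQy , lD ← Linked-split (q ∷ Q) lp
          with N , u , eq , pNu , uy ← Joins-unsnoc q Q pQy
          = rotated k (reverse N) (≤-trans (≤-reflexive N≡Q) Q≤k) (Joins-reverse N pNu) lD
              (Unique-resp-↭ perm d) (trans (≡-sym (↭-length perm)) len) uy py pz z∈D
          where
          perm : p ∷ q ∷ Q ++ y ∷ D ↭ u ∷ reverse N ++ p ∷ y ∷ D
          perm = ↭-trans
            (↭-reflexive (cong (p ∷_) (trans (cong (_++ y ∷ D) eq) (++-assoc N (u ∷ []) (y ∷ D)))))
            (↭-flip p N u (y ∷ D))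

          -- `N` is `q ∷ Q` without its last vertex `u`, so the bound `k` carries over unchanged.
          N≡Q : length (reverse N) ≡ length Q
          N≡Q = ℕ.suc-injective (trans (cong suc (length-reverse N))
            (trans (+-comm 1 (length N)) (trans (≡-sym (length-++ N)) (≡-sym (cong length eq)))))

        rotated : ∀ k {u p y z} R {D} → length R ≤ k → Joins u R p → Linked Adj (y ∷ D) →
                  Unique (u ∷ R ++ p ∷ y ∷ D) → length (u ∷ R ++ p ∷ y ∷ D) ≡ l →
                  Adj u y → Adj p y → Adj p z → z ∈ D → K4
        rotated k {u} {p} {y} [] R≤k up lD d len uy py pz z∈D
          with t , ut , t≢p , t≢y ← third u p y
          with neighbour-on-path (up ∷ py ∷ lD) d len ut
        ... | inj₁ k4                  = k4
        ... | inj₂ (here t≡p)          = contradiction t≡p t≢p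
        ... | inj₂ (there (here t≡y))  = contradiction t≡y t≢y
        ... | inj₂ (there (there t∈D)) =
          K4-intro [] _ (Adj-sym up) py uy lD (Unique-resp-↭ (↭-flip u [] p _) d) ut t∈D pz z∈D
        rotated (suc k) {u} {p} {y} (q ∷ R) {D} (s≤s R≤k) uRp lD d len uy py pz z∈D
          -- The new neighbour must differ from `q`, the next vertex on the path, and from `y`,
          -- already known to be adjacent to `u`.
          with t , ut , t≢q , t≢y ← third u q y
          with path ← Linked-join (q ∷ R) uRp (py ∷ lD)
          with neighbour-on-path path d len ut
        ... | inj₁ k4         = k4
        ... | inj₂ (here t≡q) = contradiction t≡q t≢q
        ... | inj₂ (there t∈)
          with ∈-++⁻ R t∈
        -- The next reversal is at `p`, with `y` in the role of the farther neighbour.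
        ... | inj₂ (here refl)         = rotate k R R≤k path d len ut uy (here refl)
        ... | inj₂ (there (here t≡y))  = contradiction t≡y t≢y
        -- Both `p` and `u` are adjacent to `y`, and each has a neighbour on the path beyond `y`:
        -- `z` and `t`.
        ... | inj₂ (there (there t∈D)) =
          K4-intro (reverse (q ∷ R)) _ (Joins-reverse (q ∷ R) uRp) py uy lD
            (Unique-resp-↭ (↭-flip u (q ∷ R) p _) d) ut t∈D pz z∈D
        ... | inj₁ t∈R
          with R₁ , R₂ , refl ← ∈-∃++ t∈R
          rewrite ++-assoc R₁ (t ∷ R₂) (p ∷ y ∷ D)
          -- The next reversal is at `t`; only `R₁` lies between `q` and `t`, and `y` is the farther
          -- neighbour.
          = rotate k R₁
              (≤-trans (≤-trans (m≤m+n _ _) (≤-reflexive (≡-sym (length-++ R₁)))) R≤k)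
              path d len ut uy (∈-++⁺ʳ R₂ (there (here refl)))

      -- The end has two neighbours besides its successor `q`; the first reversal takes place at
      -- whichever comes earlier on the path.
      path⇒K4 : ∀ {v L} → Linked Adj (v ∷ L) → Unique (v ∷ L) → length (v ∷ L) ≡ l → K4
      path⇒K4 {v} {[]} p d len
        with t , vt , _ ← third v v v
        with neighbour-on-path p d len vt
      ... | inj₁ k4 = k4
      path⇒K4 {v} {q ∷ Q} p d len
        with y , vy , y≢q , _ ← third v q q
        with z , vz , z≢q , z≢y ← third v q y
        with neighbour-on-path p d len vy | neighbour-on-path p d len vz
      ... | inj₁ k4         | _               = k4
      ... | _               | inj₁ k4         = k4
      ... | inj₂ (here y≡q) | _               = contradiction y≡q y≢q
      ... | _               | inj₂ (here z≡q) = contradiction z≡q z≢q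
      ... | inj₂ (there y∈Q) | inj₂ (there z∈Q)
        with Q₁ , Q₂ , refl ← ∈-∃++ y∈Q
        with ∈-++⁻ Q₁ z∈Q
      ... | inj₂ (here z≡y)   = contradiction z≡y z≢y
      ... | inj₂ (there z∈Q₂) = rotate _ Q₁ ≤-refl p d len vy vz z∈Q₂
      ... | inj₁ z∈Q₁
        with Q₃ , Q₄ , refl ← ∈-∃++ z∈Q₁
        rewrite ++-assoc Q₃ (z ∷ Q₄) (y ∷ Q₂)
        = rotate _ Q₃ ≤-refl p d len vz vy (∈-++⁺ʳ Q₄ (here refl))

    -- Replaces the choice of a longest path by induction: `k` limits how many more times the path
    -- can be extended, since its vertices are distinct and there are only `n` of them.
    long-path⇒K4 : ∀ k {v L} → Linked Adj (v ∷ L) → Unique (v ∷ L) → n < k + length (v ∷ L) → K4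
    long-path⇒K4 zero    p d n< = contradiction (injective⇒≤ (lookup-injective d)) (<⇒≱ n<)
    long-path⇒K4 (suc k) {v} {L} p d n< = path⇒K4 (length (v ∷ L)) longer p d refl
      where
      longer : ∀ {v′ L′} → Linked Adj (v′ ∷ L′) → Unique (v′ ∷ L′) → length L′ ≡ length (v ∷ L) → K4
      longer p′ d′ len = long-path⇒K4 k p′ d′
        (≤-trans n< (≤-reflexive (trans (≡-sym (+-suc k _)) (cong (λ m → k + suc m) (≡-sym len)))))

    third-neighbours⇒K4 : V → K4
    third-neighbours⇒K4 v = long-path⇒K4 n {v} {[]} [-] ([] ∷ []) (≤-reflexive (+-comm 1 n))

  -- Degrees

  neighbours : V → List V
  neighbours v = filter (λ t → adj G v t ≟ᵇ true) (allFin n)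

  degree≡length-neighbours : ∀ v → degree G v ≡ length (neighbours v)
  degree≡length-neighbours v = count (allFin n)
    where
    count : ∀ xs → sum (map (λ t → if adj G v t then 1 else 0) xs)
                   ≡ length (filter (λ t → adj G v t ≟ᵇ true) xs)
    count []       = refl
    count (x ∷ xs) with adj G v x
    ... | true  = cong suc (count xs)
    ... | false = count xs

  neighbour⇒degree≢0 : ∀ {v t} → Adj v t → degree G v ≢ 0
  neighbour⇒degree≢0 {v} vt deg≡0
    with neighbours v | ∈-filter⁺ (λ t → adj G v t ≟ᵇ true) (∈-allFin _) vt | degree≡length-neighbours v
  ... | _ ∷ _ | _ | eq with trans (≡-sym eq) deg≡0
  ... | ()

  degree≥3⇒third : ∀ v → 3 ≤ degree G v → ∀ q r → ∃[ t ] (Adj v t × t ≢ q × t ≢ r)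
  degree≥3⇒third v 3≤ q r
    with neighbours v | all-filter (λ t → adj G v t ≟ᵇ true) (allFin n)
       | filter⁺ (λ t → adj G v t ≟ᵇ true) (allFin⁺ n)
       | subst (3 ≤_) (degree≡length-neighbours v) 3≤
  ... | []            | _                 | _                                      | ()
  ... | _ ∷ []        | _                 | _                                      | s≤s ()
  ... | _ ∷ _ ∷ []    | _                 | _                                      | s≤s (s≤s ())
  ... | x ∷ y ∷ z ∷ _ | vx ∷ vy ∷ vz ∷ _ | (x≢y ∷ x≢z ∷ _) ∷ (y≢z ∷ _) ∷ _ | _
    with x ≟ q | x ≟ r | y ≟ q | y ≟ r
  ... | no x≢q   | no x≢r   | _        | _        = x , vx , x≢q , x≢r
  ... | _        | _        | no y≢q   | no y≢r   = y , vy , y≢q , y≢r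
  -- From here on `x` and `y` are each equal to `q` or `r`; being distinct, they exhaust both, and
  -- `z` avoids them.
  ... | yes refl | _        | yes refl | _        = contradiction refl x≢y
  ... | _        | yes refl | _        | yes refl = contradiction refl x≢y
  ... | yes refl | _        | _        | yes refl = z , vz , x≢z ∘ ≡-sym , y≢z ∘ ≡-sym
  ... | _        | yes refl | yes refl | _        = z , vz , y≢z ∘ ≡-sym , x≢z ∘ ≡-sym

  Walk⇒neighbour : ∀ {u v} → u ≢ v → Walk G u v → ∃[ t ] Adj u t
  Walk⇒neighbour u≢v here        = contradiction refl u≢v
  Walk⇒neighbour _   (step ut _) = _ , ut

  -- A cycle supplies two distinct vertices, so some vertex differs from `v`, and a walk to it
  -- begins with an edge at `v`. This excludes degree 0.
  connected⇒neighbour : Connected G → ∀ {k} → HasCycleOfLength G k → ∀ v → ∃[ t ] Adj v t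
  connected⇒neighbour (_ , walk) (f , s≤s (s≤s _) , inj , _) v with v ≟ f zero
  ... | no  v≢f₀ = Walk⇒neighbour v≢f₀ (walk v (f zero))
  ... | yes refl = Walk⇒neighbour (λ eq → contradiction (inj eq) λ ()) (walk v (f (suc zero)))

even∧≢0∧≢2⇒≥3 : ∀ {d} → 2 ∣ d → d ≢ 0 → d ≢ 2 → 3 ≤ d
even∧≢0∧≢2⇒≥3 (divides 0 refl)             d≢0 _   = contradiction refl d≢0
even∧≢0∧≢2⇒≥3 (divides 1 refl)             _   d≢2 = contradiction refl d≢2
even∧≢0∧≢2⇒≥3 (divides (suc (suc q)) refl) _   _   = s≤s (s≤s (s≤s z≤n))

theorem25 : ∀ {n : ℕ} (G : Graph n) → ε23 G → ∃[ v ] (degree G v ≡ 2)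
theorem25 G ((connected , even) , good , (_ , cycle , _) , _)
  with any? (λ v → degree G v ℕ.≟ 2)
... | yes found = found
... | no  none  = contradiction (third-neighbours⇒K4 G third (proj₁ connected)) (good-cycles⇒¬K4 G good)
  where
  third : ∀ v q r → ∃[ t ] (Adj G v t × t ≢ q × t ≢ r)
  third v = degree≥3⇒third G v (even∧≢0∧≢2⇒≥3 (even v)
    (neighbour⇒degree≢0 G (proj₂ (connected⇒neighbour G connected cycle v)))
    (λ deg≡2 → none (v , deg≡2)))
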